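{- Let $G$ be a graph of girth $\ge 5$ with exactly 45 vertices and exactly 145 edges. Then the minimal degree of $G$ is 6, the maximal degree of $G$ is 7, and each vertex of $G$ has exactly two neighbours with the same degree as itself.
   Context: All graphs are finite, simple and undirected. A graph has girth $\ge 5$ if it contains no cycle of length 3 or 4. -}

module Defs where

open import Data.Fin.Base using (Fin; zero; suc; inject₁; fromℕ; _<_)
open import Data.Fin.Properties using (_<?_)
open import Data.List.Base using (List; length; filter; allFin; cartesianProduct)
open import Data.Nat.Base using (ℕ; suc; _≤_)
open import Data.Nat.Properties using (_≟_)
open import Data.Product.Base using (_×_; _,_; proj₁; proj₂; ∃)
open import Function.Definitions using (Injective)
open import Level using (0ℓ)
open import Relation.Binary.Core using (Rel)
open import Relation.Binary.Definitions using (Decidable; Symmetric; Irreflexive)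
open import Relation.Binary.PropositionalEquality.Core using (_≡_)
open import Relation.Nullary.Decidable using (_×-dec_)
open import Relation.Nullary.Negation using (¬_)

record Graph (n : ℕ) : Set₁ where
  field
    Adj    : Rel (Fin n) 0ℓ
    adj?   : Decidable Adj
    sym    : Symmetric Adj
    irrefl : Irreflexive _≡_ Adj

module _ {n : ℕ} (G : Graph n) where
  open Graph G

  neighbours : Fin n → List (Fin n)
  neighbours v = filter (adj? v) (allFin n)

  degree : Fin n → ℕ
  degree v = length (neighbours v)

  -- Each undirected edge is listed once, with its smaller endpoint first.
  edges : List (Fin n × Fin n)
  edges = filter (λ e → (proj₁ e <? proj₂ e) ×-dec adj? (proj₁ e) (proj₂ e))
                 (cartesianProduct (allFin n) (allFin n))

  edgeCount : ℕ
  edgeCount = length edges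

  -- A cycle of length suc k.  This is the usual notion only for length ≥ 3:
  -- for k = 1 a single edge would qualify.
  record Cycle (k : ℕ) : Set where
    field
      vertex    : Fin (suc k) → Fin n
      injective : Injective _≡_ _≡_ vertex
      step      : (i : Fin k) → Adj (vertex (inject₁ i)) (vertex (suc i))
      close     : Adj (vertex (fromℕ k)) (vertex zero)

  -- No cycle of length 3 and none of length 4 (the index of Cycle is the
  -- length minus one).
  Girth≥5 : Set
  Girth≥5 = ¬ Cycle 2 × ¬ Cycle 3

  IsMinDegree : ℕ → Set
  IsMinDegree d = (∃ λ v → degree v ≡ d) × (∀ v → d ≤ degree v)

  IsMaxDegree : ℕ → Set
  IsMaxDegree d = (∃ λ v → degree v ≡ d) × (∀ v → degree v ≤ d)

  sameDegreeNeighbours : Fin n → List (Fin n)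
  sameDegreeNeighbours v = filter (λ w → degree w ≟ degree v) (neighbours v)

{-# OPTIONS --safe #-}

-- Let A be the adjacency matrix, D the diagonal matrix of degrees and h the
-- number of vertices of degree ≥ 7 ("heavy" vertices); let c(u) count the heavy
-- neighbours of u.  Girth ≥ 5 means A² + A + I ≤ J + D entrywise.  Evaluated
-- against 1 and against the indicator of the heavy vertices, this bounds
-- Σ d c and Σ c² + Σ_{heavy} c in terms of n and h.  Adding suitable multiples of
-- these bounds gives Σ_u P(d(u), c(u)) ≤ F(h) for explicit polynomials P and F; if
-- P ≥ 0 pointwise and F(h) < 0, the graph does not exist.
--
-- This excludes 121 edges on 40 vertices outright, and then n = 41, 42, 43, 44
-- vertices with 125, 130, 135, 140 edges: a vertex of small degree could be
-- deleted, and the remaining graphs of larger minimal degree are excluded by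
-- further choices of P.  Hence for 45 vertices and 145 edges all degrees are ≥ 6,
-- and ≤ 7 because the degrees of the neighbours of a vertex sum to at most 44.
-- So h = 20, and P = (c - 4)² on degree 6, (c - 2)² on degree 7 gives F(20) = 0;
-- thus P vanishes at every vertex.
module Submission where

open import Data.Bool.Base using (if_then_else_)
open import Data.Empty using (⊥; ⊥-elim)
open import Data.Fin.Base as Fin using (Fin; zero; suc; punchIn)
open import Data.Fin.Patterns using (0F; 1F; 2F; 3F)
import Data.Fin.Properties as Fin
open import Data.List.Base using (List; []; _∷_; _++_; length; filter; tabulate; cartesianProduct; map)
open import Data.List.Properties using (length-++; filter-++; map-tabulate)
open import Data.List.Relation.Unary.All as All using (All)
open import Data.List.Relation.Unary.Any as Any using (Any)
open import Data.List.Membership.Propositional using (find)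
open import Data.Nat.Base
open import Data.Nat.Properties
open import Data.Nat.Tactic.RingSolver using (solve-∀)
open import Data.Product.Base using (_×_; _,_; proj₁; proj₂; ∃)
open import Data.Vec.Base using (lookup; []; _∷_)
open import Function.Base using (_∘_; id; const)
open import Function.Definitions using (Injective)
open import Level using (0ℓ)
open import Relation.Binary.Definitions using (tri<; tri≈; tri>)
open import Relation.Binary.PropositionalEquality
  using (_≡_; _≢_; refl; sym; trans; cong; cong₂; subst; module ≡-Reasoning)
open import Relation.Nullary.Decidable using (Dec; yes; no; does; _×-dec_; _→-dec_; from-yes)
open import Relation.Nullary.Negation using (¬_; contradiction)
open import Relation.Unary using (Pred; Decidable)
open import Algebra.Properties.Semiring.Sum +-*-semiring
  using (sum; sum-syntax; sum-cong-≗; sum-remove; sum-replicate-zero; ∑-distrib-+; ∑-comm; *-distribˡ-sum; *-distribʳ-sum)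
open import Defs

-- Indicators and finite sums

⟦_⟧ : {A : Set} → Dec A → ℕ
⟦ a? ⟧ = if does a? then 1 else 0

⟦⟧-×-dec : {A B : Set} (a? : Dec A) (b? : Dec B) → ⟦ a? ×-dec b? ⟧ ≡ ⟦ a? ⟧ * ⟦ b? ⟧
⟦⟧-×-dec (yes _) (yes _) = refl
⟦⟧-×-dec (yes _) (no _)  = refl
⟦⟧-×-dec (no _)  _       = refl

⟦⟧-cong : {A B : Set} (a? : Dec A) (b? : Dec B) → (A → B) → (B → A) → ⟦ a? ⟧ ≡ ⟦ b? ⟧
⟦⟧-cong (yes _) (yes _) _ _ = refl
⟦⟧-cong (yes a) (no ¬b) f _ = contradiction (f a) ¬b
⟦⟧-cong (no ¬a) (yes b) _ g = contradiction (g b) ¬a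
⟦⟧-cong (no _)  (no _)  _ _ = refl

⟦⟧-yes : {A : Set} (a? : Dec A) → A → ⟦ a? ⟧ ≡ 1
⟦⟧-yes (yes _) _ = refl
⟦⟧-yes (no ¬a) a = contradiction a ¬a

⟦⟧-no : {A : Set} (a? : Dec A) → ¬ A → ⟦ a? ⟧ ≡ 0
⟦⟧-no (yes a) ¬a = contradiction a ¬a
⟦⟧-no (no _)  _  = refl

⟦⟧≤1 : {A : Set} (a? : Dec A) → ⟦ a? ⟧ ≤ 1
⟦⟧≤1 (yes _) = ≤-refl
⟦⟧≤1 (no _)  = z≤n

⟦⟧-idem : {A : Set} (a? : Dec A) → ⟦ a? ⟧ * ⟦ a? ⟧ ≡ ⟦ a? ⟧
⟦⟧-idem (yes _) = refl
⟦⟧-idem (no _)  = refl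

sum-mono : ∀ {n} {f g : Fin n → ℕ} → (∀ i → f i ≤ g i) → sum f ≤ sum g
sum-mono {zero}  f≤g = z≤n
sum-mono {suc n} f≤g = +-mono-≤ (f≤g zero) (sum-mono (f≤g ∘ suc))

sum-const : ∀ n x → ∑[ i < n ] x ≡ x * n
sum-const zero    x = sym (*-zeroʳ x)
sum-const (suc n) x = trans (cong (x +_) (sum-const n x)) (sym (*-suc x n))

-- With term `i` removed, `f` still sums to at most as much as `g`; so `g i` above `f i` would make
-- `sum g` exceed `sum f`.
sum-tight : ∀ {n} {f g : Fin n → ℕ} → (∀ i → f i ≤ g i) → sum g ≤ sum f → ∀ i → f i ≡ g i
sum-tight {suc n} {f} {g} f≤g Σg≤Σf i = ≤-antisym (f≤g i) (+-cancelʳ-≤ _ _ _ (begin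
  g i + sum (g ∘ punchIn i)  ≡⟨ sum-remove g ⟨
  sum g                      ≤⟨ Σg≤Σf ⟩
  sum f                      ≡⟨ sum-remove f ⟩
  f i + sum (f ∘ punchIn i)  ≤⟨ +-monoʳ-≤ (f i) (sum-mono (f≤g ∘ punchIn i)) ⟩
  f i + sum (g ∘ punchIn i)  ∎))
  where open ≤-Reasoning

module _ {n} {P : Pred (Fin n) 0ℓ} (P? : Decidable P) where

  count : ℕ
  count = ∑[ i < n ] ⟦ P? i ⟧

  count-none : (∀ i → ¬ P i) → count ≡ 0
  count-none ¬P = trans (sum-cong-≗ λ i → ⟦⟧-no (P? i) (¬P i)) (sum-replicate-zero n)

  count≤n : count ≤ n
  count≤n = ≤-trans (sum-mono (⟦⟧≤1 ∘ P?)) (≤-reflexive (trans (sum-const n 1) (+-identityʳ n)))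

count≤1 : ∀ {n} {P : Pred (Fin n) 0ℓ} (P? : Decidable P) →
          (∀ {i j} → P i → P j → i ≡ j) → count P? ≤ 1
count≤1 {zero}  P? unique = z≤n
count≤1 {suc n} P? unique with P? zero
... | yes p = s≤s (≤-reflexive (count-none (P? ∘ suc) λ i q → contradiction (unique p q) λ ()))
... | no  _ = count≤1 (P? ∘ suc) (λ p q → Fin.suc-injective (unique p q))

sum-at : ∀ {n} (i : Fin n) (f : Fin n → ℕ) → ∑[ j < n ] (⟦ i Fin.≟ j ⟧ * f j) ≡ f i
sum-at {suc n} i f = begin
  ∑[ j < suc n ] (⟦ i Fin.≟ j ⟧ * f j)
    ≡⟨ sum-remove {i = i} (λ j → ⟦ i Fin.≟ j ⟧ * f j) ⟩
  ⟦ i Fin.≟ i ⟧ * f i + ∑[ j < n ] (⟦ i Fin.≟ punchIn i j ⟧ * f (punchIn i j))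
    ≡⟨ cong₂ _+_
         (cong (_* f i) (⟦⟧-yes (i Fin.≟ i) refl))
         (trans (sum-cong-≗ λ j → cong (_* f (punchIn i j))
                   (⟦⟧-no (i Fin.≟ punchIn i j) (Fin.punchInᵢ≢i i j ∘ sym)))
                (sum-replicate-zero n)) ⟩
  1 * f i + 0
    ≡⟨ trans (+-identityʳ _) (*-identityˡ _) ⟩
  f i ∎
  where open ≡-Reasoning

-- Lengths of filtered lists as sums of indicators

length-filter-tabulate : ∀ {A : Set} {P : Pred A 0ℓ} (P? : Decidable P) {n} (f : Fin n → A) →
                         length (filter P? (tabulate f)) ≡ ∑[ i < n ] ⟦ P? (f i) ⟧
length-filter-tabulate P? {zero}  f = refl
length-filter-tabulate P? {suc n} f with P? (f zero)
... | yes _ = cong suc (length-filter-tabulate P? (f ∘ suc))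
... | no  _ = length-filter-tabulate P? (f ∘ suc)

length-filter-filter-tabulate :
  ∀ {A : Set} {P Q : Pred A 0ℓ} (P? : Decidable P) (Q? : Decidable Q) {n} (f : Fin n → A) →
  length (filter P? (filter Q? (tabulate f))) ≡ ∑[ i < n ] (⟦ Q? (f i) ⟧ * ⟦ P? (f i) ⟧)
length-filter-filter-tabulate P? Q? {zero}  f = refl
length-filter-filter-tabulate P? Q? {suc n} f with Q? (f zero)
... | no  _ = length-filter-filter-tabulate P? Q? (f ∘ suc)
... | yes _ with P? (f zero)
...   | yes _ = cong suc (length-filter-filter-tabulate P? Q? (f ∘ suc))
...   | no  _ = length-filter-filter-tabulate P? Q? (f ∘ suc)

length-filter-cartesianProduct :
  ∀ {A B : Set} {P : Pred (A × B) 0ℓ} (P? : Decidable P) {m n} (f : Fin m → A) (g : Fin n → B) →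
  length (filter P? (cartesianProduct (tabulate f) (tabulate g))) ≡
  ∑[ i < m ] ∑[ j < n ] ⟦ P? (f i , g j) ⟧
length-filter-cartesianProduct P? {zero}  f g = refl
length-filter-cartesianProduct P? {suc m} f g = begin
  length (filter P? (row ++ rest))                   ≡⟨ cong length (filter-++ P? row rest) ⟩
  length (filter P? row ++ filter P? rest)           ≡⟨ length-++ (filter P? row) ⟩
  length (filter P? row) + length (filter P? rest)   ≡⟨ cong₂ _+_
    (trans (cong (length ∘ filter P?) (map-tabulate g (f zero ,_))) (length-filter-tabulate P? λ j → f zero , g j))
    (length-filter-cartesianProduct P? (f ∘ suc) g) ⟩
  _                                                  ∎
  where
  open ≡-Reasoning
  row  = map (f zero ,_) (tabulate g)
  rest = cartesianProduct (tabulate (f ∘ suc)) (tabulate g)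

-- The adjacency operator and the handshake identity

heavy : ℕ → ℕ
heavy d = ⟦ 7 ≤? d ⟧

module Counting {n} (G : Graph n) where
  open Graph G renaming (sym to Adj-sym)

  α : Fin n → Fin n → ℕ
  α u v = ⟦ adj? u v ⟧

  α-sym : ∀ u v → α u v ≡ α v u
  α-sym u v = ⟦⟧-cong (adj? u v) (adj? v u) Adj-sym Adj-sym

  Â : (Fin n → ℕ) → Fin n → ℕ
  Â f u = ∑[ v < n ] (α u v * f v)

  d : Fin n → ℕ
  d = degree G

  d-sum : ∀ u → d u ≡ sum (α u)
  d-sum u = length-filter-tabulate (adj? u) id

  degreeSum : ℕ
  degreeSum = sum d

  H c : Fin n → ℕ
  H = heavy ∘ d
  c = Â H

  h : ℕ
  h = sum H

  Â-1 : ∀ u → Â (const 1) u ≡ d u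
  Â-1 u = trans (sum-cong-≗ λ v → *-identityʳ (α u v)) (sym (d-sum u))

  -- The adjacency matrix is symmetric. This serves to move it from the indicator `H` to the other
  -- factor, which leaves sums over the heavy vertices only.
  Â-selfAdjoint : ∀ f g → ∑[ u < n ] (f u * Â g u) ≡ ∑[ u < n ] (g u * Â f u)
  Â-selfAdjoint f g = begin
    ∑[ u < n ] (f u * Â g u)
      ≡⟨ sum-cong-≗ (λ u → *-distribˡ-sum (f u) (λ v → α u v * g v)) ⟩
    ∑[ u < n ] ∑[ v < n ] (f u * (α u v * g v))
      ≡⟨ ∑-comm (λ u v → f u * (α u v * g v)) ⟩
    ∑[ v < n ] ∑[ u < n ] (f u * (α u v * g v))
      ≡⟨ sum-cong-≗ (λ v → sum-cong-≗ λ u →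
           trans (cong (λ a → f u * (a * g v)) (α-sym u v)) (swap (f u) (α v u) (g v))) ⟩
    ∑[ v < n ] ∑[ u < n ] (g v * (α v u * f u))
      ≡⟨ sum-cong-≗ (λ v → *-distribˡ-sum (g v) (λ u → α v u * f u)) ⟨
    ∑[ v < n ] (g v * Â f v) ∎
    where
    open ≡-Reasoning
    swap : ∀ x a y → x * (a * y) ≡ y * (a * x)
    swap = solve-∀

  c≤d : ∀ u → c u ≤ d u
  c≤d u = ≤-trans
    (sum-mono λ v → ≤-trans (*-monoʳ-≤ (α u v) (⟦⟧≤1 (7 ≤? d v))) (≤-reflexive (*-identityʳ (α u v))))
    (≤-reflexive (sym (d-sum u)))

  d≤n : ∀ u → d u ≤ n
  d≤n u = ≤-trans (≤-reflexive (d-sum u)) (count≤n (adj? u))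

  -- The adjacency matrix is the sum of its strict upper triangle `β` and the transpose of `β`, and
  -- `edges` lists the entries of `β`.
  handshake : degreeSum ≡ edgeCount G + edgeCount G
  handshake = begin
    sum d                                              ≡⟨ sum-cong-≗ d-sum ⟩
    ∑[ u < n ] ∑[ v < n ] α u v                        ≡⟨ sum-cong-≗ (λ u → sum-cong-≗ (split u)) ⟩
    ∑[ u < n ] ∑[ v < n ] (β u v + β v u)              ≡⟨ sum-cong-≗ (λ u → ∑-distrib-+ (β u) (λ v → β v u)) ⟩
    ∑[ u < n ] (sum (β u) + ∑[ v < n ] β v u)          ≡⟨ ∑-distrib-+ (λ u → sum (β u)) (λ u → ∑[ v < n ] β v u) ⟩
    (∑[ u < n ] ∑[ v < n ] β u v) + (∑[ u < n ] ∑[ v < n ] β v u)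
      ≡⟨ cong ((∑[ u < n ] ∑[ v < n ] β u v) +_) (∑-comm (λ u v → β v u)) ⟩
    (∑[ u < n ] ∑[ v < n ] β u v) + (∑[ u < n ] ∑[ v < n ] β u v)
      ≡⟨ cong₂ _+_ count-edges count-edges ⟨
    edgeCount G + edgeCount G                          ∎
    where
    open ≡-Reasoning
    β : Fin n → Fin n → ℕ
    β u v = ⟦ (u Fin.<? v) ×-dec adj? u v ⟧
    count-edges : edgeCount G ≡ ∑[ u < n ] ∑[ v < n ] β u v
    count-edges = length-filter-cartesianProduct
      (λ e → (proj₁ e Fin.<? proj₂ e) ×-dec adj? (proj₁ e) (proj₂ e)) id id
    split : ∀ u v → α u v ≡ β u v + β v u
    split u v with Fin.<-cmp u v
    ... | tri< u<v _ v≮u = sym (trans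
          (cong₂ _+_ (⟦⟧-cong ((u Fin.<? v) ×-dec adj? u v) (adj? u v) proj₂ (u<v ,_))
                     (⟦⟧-no ((v Fin.<? u) ×-dec adj? v u) (v≮u ∘ proj₁)))
          (+-identityʳ _))
    ... | tri> u≮v _ v<u = sym
          (cong₂ _+_ (⟦⟧-no ((u Fin.<? v) ×-dec adj? u v) (u≮v ∘ proj₁))
                     (⟦⟧-cong ((v Fin.<? u) ×-dec adj? v u) (adj? u v)
                        (Adj-sym ∘ proj₂) (λ a → v<u , Adj-sym a)))
    ... | tri≈ u≮v u≡v v≮u = trans (⟦⟧-no (adj? u v) (irrefl u≡v)) (sym
          (cong₂ _+_ (⟦⟧-no ((u Fin.<? v) ×-dec adj? u v) (u≮v ∘ proj₁))
                     (⟦⟧-no ((v Fin.<? u) ×-dec adj? v u) (v≮u ∘ proj₁))))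

  -- Consequences of girth at least 5

  module _ (girth : Girth≥5 G) where

    adj⇒≢ : ∀ {u v} → Adj u v → u ≢ v
    adj⇒≢ a u≡v = irrefl u≡v a

    no-triangle : ∀ {u v w} → Adj u v → Adj v w → ¬ Adj w u
    no-triangle {u} {v} {w} uv vw wu = proj₁ girth record
      { vertex = vertex ; injective = inj ; step = λ { 0F → uv ; 1F → vw } ; close = wu }
      where
      vertex : Fin 3 → Fin n
      vertex = lookup (u ∷ v ∷ w ∷ [])
      inj : Injective _≡_ _≡_ vertex
      inj {0F} {0F} _ = refl
      inj {0F} {1F} e = contradiction e (adj⇒≢ uv)
      inj {0F} {2F} e = contradiction (sym e) (adj⇒≢ wu)
      inj {1F} {0F} e = contradiction (sym e) (adj⇒≢ uv)
      inj {1F} {1F} _ = refl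
      inj {1F} {2F} e = contradiction e (adj⇒≢ vw)
      inj {2F} {0F} e = contradiction e (adj⇒≢ wu)
      inj {2F} {1F} e = contradiction (sym e) (adj⇒≢ vw)
      inj {2F} {2F} _ = refl

    no-4-cycle : ∀ {u v w x} → u ≢ w → v ≢ x → Adj u v → Adj v w → Adj w x → ¬ Adj x u
    no-4-cycle {u} {v} {w} {x} u≢w v≢x uv vw wx xu = proj₂ girth record
      { vertex = vertex ; injective = inj ; step = λ { 0F → uv ; 1F → vw ; 2F → wx } ; close = xu }
      where
      vertex : Fin 4 → Fin n
      vertex = lookup (u ∷ v ∷ w ∷ x ∷ [])
      inj : Injective _≡_ _≡_ vertex
      inj {0F} {0F} _ = refl
      inj {0F} {1F} e = contradiction e (adj⇒≢ uv)
      inj {0F} {2F} e = contradiction e u≢w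
      inj {0F} {3F} e = contradiction (sym e) (adj⇒≢ xu)
      inj {1F} {0F} e = contradiction (sym e) (adj⇒≢ uv)
      inj {1F} {1F} _ = refl
      inj {1F} {2F} e = contradiction e (adj⇒≢ vw)
      inj {1F} {3F} e = contradiction e v≢x
      inj {2F} {0F} e = contradiction (sym e) u≢w
      inj {2F} {1F} e = contradiction (sym e) (adj⇒≢ vw)
      inj {2F} {2F} _ = refl
      inj {2F} {3F} e = contradiction e (adj⇒≢ wx)
      inj {3F} {0F} e = contradiction e (adj⇒≢ xu)
      inj {3F} {1F} e = contradiction (sym e) v≢x
      inj {3F} {2F} e = contradiction (sym e) (adj⇒≢ wx)
      inj {3F} {3F} _ = refl

    -- The entries of A², counting walks of length two.
    paths : Fin n → Fin n → ℕ
    paths u v = ∑[ w < n ] (α u w * α w v)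

    paths-self : ∀ u → paths u u ≡ d u
    paths-self u = trans
      (sum-cong-≗ λ w → trans (cong (α u w *_) (α-sym w u)) (⟦⟧-idem (adj? u w)))
      (sym (d-sum u))

    -- A common neighbour of adjacent vertices closes a triangle, and two common neighbours of
    -- distinct vertices close a 4-cycle.
    paths+α≤1 : ∀ {u v} → u ≢ v → paths u v + α u v ≤ 1
    paths+α≤1 {u} {v} u≢v = subst (λ p → p + α u v ≤ 1)
      (sum-cong-≗ λ w → ⟦⟧-×-dec (adj? u w) (adj? w v)) bound
      where
      between? : Decidable (λ w → Adj u w × Adj w v)
      between? w = adj? u w ×-dec adj? w v
      bound : count between? + α u v ≤ 1
      bound with adj? u v
      ... | yes uv = ≤-reflexive (cong (_+ 1)
              (count-none between? λ w (uw , wv) → no-triangle uw wv (Adj-sym uv)))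
      ... | no  _  = ≤-trans (≤-reflexive (+-identityʳ _)) (count≤1 between? unique)
        where
        unique : ∀ {w x} → Adj u w × Adj w v → Adj u x × Adj x v → w ≡ x
        unique {w} {x} (uw , wv) (ux , xv) with w Fin.≟ x
        ... | yes w≡x = w≡x
        ... | no  w≢x = ⊥-elim (no-4-cycle u≢v w≢x uw wv (Adj-sym xv) (Adj-sym ux))

    -- Off the diagonal this is `paths+α≤1`. On the diagonal both sides are `d u + 1`, since a walk
    -- of length two from `u` back to `u` is a choice of neighbour.
    moore-entry : ∀ u v → paths u v + α u v + ⟦ u Fin.≟ v ⟧ ≤ 1 + ⟦ u Fin.≟ v ⟧ * d u
    moore-entry u v with u Fin.≟ v
    ... | no  u≢v  = ≤-trans (≤-reflexive (+-identityʳ _)) (paths+α≤1 u≢v)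
    ... | yes refl = ≤-reflexive (begin
      paths u u + α u u + 1   ≡⟨ cong₂ (λ p a → p + a + 1) (paths-self u) (⟦⟧-no (adj? u u) (irrefl refl)) ⟩
      d u + 0 + 1             ≡⟨ rearrange (d u) ⟩
      1 + 1 * d u             ∎)
      where
      open ≡-Reasoning
      rearrange : ∀ x → x + 0 + 1 ≡ 1 + 1 * x
      rearrange = solve-∀

    Â² : ∀ f u → Â (Â f) u ≡ ∑[ v < n ] (paths u v * f v)
    Â² f u = begin
      ∑[ w < n ] (α u w * ∑[ v < n ] (α w v * f v))
        ≡⟨ sum-cong-≗ (λ w → *-distribˡ-sum (α u w) (λ v → α w v * f v)) ⟩
      ∑[ w < n ] ∑[ v < n ] (α u w * (α w v * f v))
        ≡⟨ ∑-comm (λ w v → α u w * (α w v * f v)) ⟩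
      ∑[ v < n ] ∑[ w < n ] (α u w * (α w v * f v))
        ≡⟨ sum-cong-≗ (λ v → trans
             (sum-cong-≗ λ w → sym (*-assoc (α u w) (α w v) (f v)))
             (sym (*-distribʳ-sum (f v) (λ w → α u w * α w v)))) ⟩
      ∑[ v < n ] (paths u v * f v) ∎
      where open ≡-Reasoning

    -- The entrywise matrix inequality A² + A + I ≤ J + D, applied to a
    -- non-negative vector.
    moore : ∀ f u → Â (Â f) u + Â f u + f u ≤ sum f + f u * d u
    moore f u = begin
      Â (Â f) u + Â f u + f u
        ≡⟨ cong₂ (λ p e → p + Â f u + e) (Â² f u) (sym (sum-at u f)) ⟩
      ∑[ v < n ] (paths u v * f v) + ∑[ v < n ] (α u v * f v) + ∑[ v < n ] (ε v * f v)
        ≡⟨ cong (_+ ∑[ v < n ] (ε v * f v))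
             (sym (∑-distrib-+ (λ v → paths u v * f v) (λ v → α u v * f v))) ⟩
      ∑[ v < n ] (paths u v * f v + α u v * f v) + ∑[ v < n ] (ε v * f v)
        ≡⟨ sym (∑-distrib-+ (λ v → paths u v * f v + α u v * f v) (λ v → ε v * f v)) ⟩
      ∑[ v < n ] (paths u v * f v + α u v * f v + ε v * f v)
        ≤⟨ sum-mono entry ⟩
      ∑[ v < n ] (f v + ε v * (f v * d u))
        ≡⟨ ∑-distrib-+ f (λ v → ε v * (f v * d u)) ⟩
      sum f + ∑[ v < n ] (ε v * (f v * d u))
        ≡⟨ cong (sum f +_) (sum-at u (λ v → f v * d u)) ⟩
      sum f + f u * d u ∎
      where
      open ≤-Reasoning
      ε : Fin n → ℕ
      ε v = ⟦ u Fin.≟ v ⟧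
      collect : ∀ p a e x → p * x + a * x + e * x ≡ (p + a + e) * x
      collect = solve-∀
      expand : ∀ e x y → (1 + e * y) * x ≡ x + e * (x * y)
      expand = solve-∀
      entry : ∀ v → paths u v * f v + α u v * f v + ε v * f v ≤ f v + ε v * (f v * d u)
      entry v = ≤-trans (≤-reflexive (collect (paths u v) (α u v) (ε v) (f v)))
        (≤-trans (*-monoˡ-≤ (f v) (moore-entry u v)) (≤-reflexive (expand (ε v) (f v) (d u))))

    -- This is `moore` for the all-ones vector, with `d u` cancelled: `u`, its neighbours and their
    -- other neighbours are all distinct.
    Âd<n : ∀ u → Â d u + 1 ≤ n
    Âd<n u = +-cancelʳ-≤ (d u) _ _ (begin
      Â d u + 1 + d u                                 ≡⟨ swap (Â d u) (d u) ⟩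
      Â d u + d u + 1                                 ≡⟨ cong₂ (λ x y → x + y + 1)
                                                           (sum-cong-≗ λ v → cong (α u v *_) (sym (Â-1 v)))
                                                           (sym (Â-1 u)) ⟩
      Â (Â (const 1)) u + Â (const 1) u + 1           ≤⟨ moore (const 1) u ⟩
      ∑[ v < n ] 1 + 1 * d u                          ≡⟨ cong₂ _+_ (trans (sum-const n 1) (*-identityˡ n)) (*-identityˡ (d u)) ⟩
      n + d u                                         ∎)
      where
      open ≤-Reasoning
      swap : ∀ x y → x + 1 + y ≡ x + y + 1
      swap = solve-∀

    Σc : sum c ≡ ∑[ u < n ] (H u * d u)
    Σc = begin
      sum c                             ≡⟨ sum-cong-≗ (λ u → sym (*-identityˡ (c u))) ⟩
      ∑[ u < n ] (1 * Â H u)            ≡⟨ Â-selfAdjoint (const 1) H ⟩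
      ∑[ u < n ] (H u * Â (const 1) u)  ≡⟨ sum-cong-≗ (λ u → cong (H u *_) (Â-1 u)) ⟩
      ∑[ u < n ] (H u * d u)            ∎
      where open ≡-Reasoning

    -- By self-adjointness the sum runs over the heavy vertices and adds up the degrees of their
    -- neighbours, at most n - 1 for each by `Âd<n`.
    Σdc : ∑[ u < n ] (d u * c u) + h ≤ n * h
    Σdc = begin
      ∑[ u < n ] (d u * c u) + h            ≡⟨ cong (_+ h) (Â-selfAdjoint d H) ⟩
      ∑[ u < n ] (H u * Â d u) + h          ≡⟨ ∑-distrib-+ (λ u → H u * Â d u) H ⟨
      ∑[ u < n ] (H u * Â d u + H u)        ≤⟨ sum-mono (λ u → ≤-trans
                                                 (≤-reflexive (factor (H u) (Â d u)))
                                                 (*-monoʳ-≤ (H u) (Âd<n u))) ⟩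
      ∑[ u < n ] (H u * n)                  ≡⟨ *-distribʳ-sum n H ⟨
      h * n                                 ≡⟨ *-comm h n ⟩
      n * h                                 ∎
      where
      open ≤-Reasoning
      factor : ∀ x y → x * y + x ≡ x * (y + 1)
      factor = solve-∀

    -- Self-adjointness turns the sum of squares into the sum of `Â c` over the heavy vertices,
    -- where `moore` for `H` applies; its degree terms add up to `sum c` by `Σc`.
    Σc² : ∑[ u < n ] (c u * c u) + ∑[ u < n ] (H u * c u) + h ≤ h * h + sum c
    Σc² = begin
      ∑[ u < n ] (c u * c u) + ∑[ u < n ] (H u * c u) + h
        ≡⟨ cong (λ x → x + ∑[ u < n ] (H u * c u) + h) (Â-selfAdjoint c H) ⟩
      ∑[ u < n ] (H u * Â c u) + ∑[ u < n ] (H u * c u) + h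
        ≡⟨ cong (_+ h) (∑-distrib-+ (λ u → H u * Â c u) (λ u → H u * c u)) ⟨
      ∑[ u < n ] (H u * Â c u + H u * c u) + h
        ≡⟨ ∑-distrib-+ (λ u → H u * Â c u + H u * c u) H ⟨
      ∑[ u < n ] (H u * Â c u + H u * c u + H u)
        ≤⟨ sum-mono (λ u → step (7 ≤? d u) (moore H u)) ⟩
      ∑[ u < n ] (H u * h + H u * d u)
        ≡⟨ ∑-distrib-+ (λ u → H u * h) (λ u → H u * d u) ⟩
      ∑[ u < n ] (H u * h) + ∑[ u < n ] (H u * d u)
        ≡⟨ cong₂ _+_ (sym (*-distribʳ-sum h H)) (sym Σc) ⟩
      h * h + sum c ∎
      where
      open ≤-Reasoning
      -- Multiplies the instance of `moore` by the indicator, which is its own square.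
      step : ∀ {A : Set} (a? : Dec A) {x y s t : ℕ} → x + y + ⟦ a? ⟧ ≤ s + ⟦ a? ⟧ * t →
             ⟦ a? ⟧ * x + ⟦ a? ⟧ * y + ⟦ a? ⟧ ≤ ⟦ a? ⟧ * s + ⟦ a? ⟧ * t
      step (no _)  _ = z≤n
      step (yes _) {x} {y} {s} {t} p = subst (λ z → z ≤ 1 * s + 1 * t) (lhs x y) (subst (x + y + 1 ≤_) (rhs s t) p)
        where
        lhs : ∀ x y → x + y + 1 ≡ 1 * x + 1 * y + 1
        lhs = solve-∀
        rhs : ∀ s t → s + 1 * t ≡ 1 * s + 1 * t
        rhs = solve-∀

-- Linear combinations of the bounds

-- λ', μ, ν and κ multiply Σdc, Σc, the bound on the degree sum and the definition
-- of h.  The polynomials P and F above are split into two sides so that no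
-- subtraction occurs: P = supply - demand, and Refutes says F(h) < 0.
record Multipliers : Set where
  constructor mult
  field
    λ' μ ν κ ρ : ℕ

  demand supply : ℕ → ℕ → ℕ
  demand d c = (1 + μ) * c + ν * d + κ * heavy d
  supply d c = c * c + heavy d * c + λ' * (d * c) + μ * (heavy d * d) + ρ

  -- The bounds d ≤ n and c ≤ d hold at every vertex and make this a finite check.
  Valid : (n δ : ℕ) → Set
  Valid n δ = ∀ {d} → d < suc n → ∀ {c} → c < suc d → δ ≤ d → demand d c ≤ supply d c

  valid? : ∀ n δ → Dec (Valid n δ)
  valid? n δ = allUpTo? (λ d → allUpTo? (λ c → (δ ≤? d) →-dec (demand d c ≤? supply d c)) (suc d)) (suc n)

  Refutes : (n D h : ℕ) → Set
  Refutes n D h = h * h + λ' * (n * h) + ρ * n < ν * D + (1 + κ + λ') * h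

  refutes? : ∀ n D h → Dec (Refutes n D h)
  refutes? n D h = _ <? _

module _ {n} (G : Graph n) (girth : Girth≥5 G) (p : Multipliers) where
  open Counting G
  open Multipliers p

  -- Takes `Σc²` once and `Σdc` `λ'` times; `rest` collects the terms with `μ`, `ν`, `κ` and `ρ`,
  -- which are the same on both sides. For `μ` this needs `Σc`, and `ρ` is a constant paid at each
  -- vertex.
  balance : ∑[ u < n ] supply (d u) (c u) + (ν * degreeSum + (1 + κ + λ') * h) ≤
            ∑[ u < n ] demand (d u) (c u) + (h * h + λ' * (n * h) + ρ * n)
  balance = begin
    ∑[ u < n ] supply (d u) (c u) + (ν * degreeSum + (1 + κ + λ') * h)
      ≡⟨ cong (_+ (ν * degreeSum + (1 + κ + λ') * h)) Σsupply ⟩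
    Σcc + ΣHc + λ' * Σdc′ + μ * sum c + ρ * n + (ν * degreeSum + (1 + κ + λ') * h)
      ≡⟨ gather-supply Σcc ΣHc λ' Σdc′ (μ * sum c) (ρ * n) (ν * degreeSum) κ h ⟩
    Σcc + ΣHc + h + λ' * (Σdc′ + h) + rest
      ≤⟨ +-monoˡ-≤ rest (+-mono-≤ (Σc² girth) (*-monoʳ-≤ λ' (Σdc girth))) ⟩
    h * h + sum c + λ' * (n * h) + rest
      ≡⟨ gather-demand μ (sum c) (ν * degreeSum) κ h (h * h) (λ' * (n * h)) (ρ * n) ⟨
    (1 + μ) * sum c + ν * degreeSum + κ * h + (h * h + λ' * (n * h) + ρ * n)
      ≡⟨ cong (_+ (h * h + λ' * (n * h) + ρ * n)) Σdemand ⟨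
    ∑[ u < n ] demand (d u) (c u) + (h * h + λ' * (n * h) + ρ * n) ∎
    where
    open ≤-Reasoning
    Σcc ΣHc Σdc′ rest : ℕ
    Σcc  = ∑[ u < n ] (c u * c u)
    ΣHc  = ∑[ u < n ] (H u * c u)
    Σdc′ = ∑[ u < n ] (d u * c u)
    rest = μ * sum c + ρ * n + ν * degreeSum + κ * h
    pull : ∀ x (f : Fin n → ℕ) → ∑[ u < n ] (x * f u) ≡ x * sum f
    pull x f = sym (*-distribˡ-sum x f)
    Σdemand : ∑[ u < n ] demand (d u) (c u) ≡ (1 + μ) * sum c + ν * degreeSum + κ * h
    Σdemand = trans (∑-distrib-+ (λ u → (1 + μ) * c u + ν * d u) (λ u → κ * H u))
      (cong₂ _+_ (trans (∑-distrib-+ (λ u → (1 + μ) * c u) (λ u → ν * d u))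
                        (cong₂ _+_ (pull (1 + μ) c) (pull ν d)))
                 (pull κ H))
    Σsupply : ∑[ u < n ] supply (d u) (c u) ≡
              Σcc + ΣHc + λ' * Σdc′ + μ * sum c + ρ * n
    Σsupply =
      trans (∑-distrib-+ (λ u → c u * c u + H u * c u + λ' * (d u * c u) + μ * (H u * d u)) (λ _ → ρ))
     (cong₂ _+_ (
      trans (∑-distrib-+ (λ u → c u * c u + H u * c u + λ' * (d u * c u)) (λ u → μ * (H u * d u)))
     (cong₂ _+_ (
      trans (∑-distrib-+ (λ u → c u * c u + H u * c u) (λ u → λ' * (d u * c u)))
     (cong₂ _+_ (∑-distrib-+ (λ u → c u * c u) (λ u → H u * c u)) (pull λ' (λ u → d u * c u))))
      (trans (pull μ (λ u → H u * d u)) (cong (μ *_) (sym (Σc girth))))))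
      (sum-const n ρ))
    gather-supply : ∀ a b l e m r q k y → a + b + l * e + m + r + (q + (1 + k + l) * y) ≡
                    a + b + y + l * (e + y) + (m + r + q + k * y)
    gather-supply = solve-∀
    gather-demand : ∀ m x q k y yy z r → (1 + m) * x + q + k * y + (yy + z + r) ≡
                    yy + x + z + (m * x + r + q + k * y)
    gather-demand = solve-∀

-- `D` is twice the number of edges. It is only a lower bound on the degree sum because vertex
-- deletion yields no more than that.
Forbidden : (n D : ℕ) → Set₁
Forbidden n D = (G : Graph n) → Girth≥5 G → D ≤ Counting.degreeSum G → ⊥

-- The number of heavy vertices is unknown, so each possible `h` may choose its own multipliers from
-- the list.
Certified : (n δ D : ℕ) → List Multipliers → Set
Certified n δ D ps =
  All (λ p → Multipliers.Valid p n δ) ps ×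
  (∀ {h} → h < suc n → Any (λ p → Multipliers.Refutes p n D h) ps)

certified? : ∀ n δ D ps → Dec (Certified n δ D ps)
certified? n δ D ps =
  All.all? (λ p → Multipliers.valid? p n δ) ps ×-dec
  allUpTo? (λ h → Any.any? (λ p → Multipliers.refutes? p n D h) ps) (suc n)

-- Summing `Valid` over the vertices and adding `Refutes` gives the strict reverse of `balance`.
minDegree-forbidden : ∀ {n δ D ps} → Certified n δ D ps → (G : Graph n) → Girth≥5 G →
                      D ≤ Counting.degreeSum G → ¬ (∀ u → δ ≤ degree G u)
minDegree-forbidden {n} {δ} {D} (valid , refuted) G girth D≤Σd δ≤d
  with p , p∈ps , refutes ← find (refuted (s≤s (count≤n (λ u → 7 ≤? degree G u))))
  = <-irrefl refl (<-≤-trans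
      (+-mono-≤-< (sum-mono λ u → All.lookup valid p∈ps (s≤s (d≤n u)) (s≤s (c≤d u)) (δ≤d u))
        (<-≤-trans refutes (+-monoˡ-≤ _ (*-monoʳ-≤ (Multipliers.ν p) D≤Σd))))
      (balance G girth p))
  where open Counting G

-- Deleting a vertex

module Deletion {n} (G : Graph (suc n)) (i : Fin (suc n)) where
  open Graph G renaming (sym to Adj-sym)
  module G = Counting G

  G∖i : Graph n
  G∖i = record
    { Adj    = λ u v → Adj (punchIn i u) (punchIn i v)
    ; adj?   = λ u v → adj? (punchIn i u) (punchIn i v)
    ; sym    = Adj-sym
    ; irrefl = λ u≡v → irrefl (cong (punchIn i) u≡v)
    }
  module G∖i = Counting G∖i

  ∖-cycle : ∀ {k} → Cycle G∖i k → Cycle G k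
  ∖-cycle C = record
    { vertex    = punchIn i ∘ vertex
    ; injective = injective ∘ Fin.punchIn-injective i _ _
    ; step      = step
    ; close     = close
    }
    where open Cycle C

  ∖-girth : Girth≥5 G → Girth≥5 G∖i
  ∖-girth (no-C₃ , no-C₄) = no-C₃ ∘ ∖-cycle , no-C₄ ∘ ∖-cycle

  -- The deletion loses the degree of `i` itself and one from each of its neighbours.
  ∖-degreeSum : G.degreeSum ≤ G.d i + G.d i + G∖i.degreeSum
  ∖-degreeSum = begin
    sum G.d
      ≡⟨ sum-remove {i = i} G.d ⟩
    G.d i + ∑[ u < n ] G.d (punchIn i u)
      ≡⟨ cong (G.d i +_) (sum-cong-≗ λ u → trans (G.d-sum (punchIn i u))
           (trans (sum-remove {i = i} (G.α (punchIn i u))) (cong₂ _+_ (G.α-sym (punchIn i u) i) (sym (G∖i.d-sum u))))) ⟩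
    G.d i + ∑[ u < n ] (G.α i (punchIn i u) + G∖i.d u)
      ≡⟨ cong (G.d i +_) (∑-distrib-+ (G.α i ∘ punchIn i) G∖i.d) ⟩
    G.d i + (sum (G.α i ∘ punchIn i) + G∖i.degreeSum)
      ≤⟨ +-monoʳ-≤ (G.d i) (+-monoˡ-≤ G∖i.degreeSum (begin
           sum (G.α i ∘ punchIn i)              ≤⟨ m≤n+m _ (G.α i i) ⟩
           G.α i i + sum (G.α i ∘ punchIn i)    ≡⟨ sum-remove {i = i} (G.α i) ⟨
           sum (G.α i)                          ≡⟨ G.d-sum i ⟨
           G.d i                                ∎)) ⟩
    G.d i + (G.d i + G∖i.degreeSum)
      ≡⟨ +-assoc (G.d i) (G.d i) _ ⟨
    G.d i + G.d i + G∖i.degreeSum ∎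
    where open ≤-Reasoning

-- Deleting a vertex of degree at most `δ` costs at most 2δ of the degree sum, so a forbidden graph
-- would remain.
forbidden⇒minDegree : ∀ {n D} δ → Forbidden n D → (G : Graph (suc n)) → Girth≥5 G →
                      δ + δ + D ≤ Counting.degreeSum G → ∀ u → suc δ ≤ degree G u
forbidden⇒minDegree {n} {D} δ forbidden G girth bound u with suc δ ≤? degree G u
... | yes δ<d = δ<d
... | no  δ≮d = ⊥-elim (forbidden G∖i (∖-girth girth) (+-cancelˡ-≤ (δ + δ) _ _ (begin
    δ + δ + D                          ≤⟨ bound ⟩
    G.degreeSum                        ≤⟨ ∖-degreeSum ⟩
    G.d u + G.d u + G∖i.degreeSum      ≤⟨ +-monoˡ-≤ G∖i.degreeSum (+-mono-≤ d≤δ d≤δ) ⟩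
    δ + δ + G∖i.degreeSum              ∎)))
  where
  open Deletion G u
  open ≤-Reasoning
  d≤δ : G.d u ≤ δ
  d≤δ = ≤-pred (≰⇒> δ≮d)

forbidden-suc : ∀ {n D} δ {ps} → Certified (suc n) (suc δ) (δ + δ + D) ps →
                Forbidden n D → Forbidden (suc n) (δ + δ + D)
forbidden-suc δ certified forbidden G girth bound =
  minDegree-forbidden certified G girth bound (forbidden⇒minDegree δ forbidden G girth bound)

-- Exclusion of 40 to 44 vertices

-- The multipliers were found by computer search; each list covers all values of h.
forbidden-40 : Forbidden 40 242
forbidden-40 G girth bound = minDegree-forbidden
  (from-yes (certified? 40 0 242
    (mult 7 43 24 278 145 ∷ mult 2 14 6 94 38 ∷ mult 2 15 6 103 40 ∷ mult 2 19 9 134 70 ∷ [])))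
  G girth bound (λ _ → z≤n)

forbidden-41 : Forbidden 41 250
-- 250 = 4 + 4 + 242, so the certificate may assume minimal degree 5. In the next three cases 10 is
-- added each time, for minimal degree 6.
forbidden-41 = forbidden-suc 4
  (from-yes (certified? 41 5 250 (mult 7 44 23 287 140 ∷ mult 3 22 10 150 66 ∷ mult 2 19 7 138 60 ∷ [])))
  forbidden-40

forbidden-42 : Forbidden 42 260
forbidden-42 = forbidden-suc 5
  (from-yes (certified? 42 6 260 (mult 2 14 11 89 68 ∷ mult 11 71 0 506 9 ∷ [])))
  forbidden-41

forbidden-43 : Forbidden 43 270
forbidden-43 = forbidden-suc 5
  (from-yes (certified? 43 6 270 (mult 3 22 22 138 138 ∷ mult 6 43 0 317 16 ∷ [])))
  forbidden-42

forbidden-44 : Forbidden 44 280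
forbidden-44 = forbidden-suc 5
  (from-yes (certified? 44 6 280 (mult 4 29 25 187 159 ∷ mult 4 32 0 240 20 ∷ [])))
  forbidden-43

-- 45 vertices and 145 edges

extremal : Multipliers
-- The linear coefficients in c are 6 * 3 - 26 = -8 for degree 6 and 1 + 7 * 3 - 26 = -4 for degree
-- 7; 16 and 187 complete the squares, as 7 * 25 + 16 - 187 = 4.
extremal = mult 3 25 0 187 16

-- The first argument of `Valid` acts as a bound on the degrees, so 7 can stand in for the number of
-- vertices once `d≤7` is known.
extremal-valid : Multipliers.Valid extremal 7 6
extremal-valid = from-yes (Multipliers.valid? extremal 7 6)

-- The slack supply - demand is (c - 4)² for d = 6 and (c - 2)² for d = 7.
extremal-tight : ∀ {d} → d < 8 → ∀ {c} → c < suc d → 6 ≤ d →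
                 Multipliers.demand extremal d c ≡ Multipliers.supply extremal d c →
                 c + 2 * heavy d ≡ 4
extremal-tight = from-yes (allUpTo? (λ d → allUpTo? (λ c → (6 ≤? d) →-dec
  ((Multipliers.demand extremal d c ≟ Multipliers.supply extremal d c) →-dec
   (c + 2 * heavy d ≟ 4))) (suc d)) 8)

module _ (G : Graph 45) (girth : Girth≥5 G) (145-edges : edgeCount G ≡ 145) where
  open Counting G

  degreeSum≡290 : degreeSum ≡ 290
  degreeSum≡290 = trans handshake (cong₂ _+_ 145-edges 145-edges)

  6≤d : ∀ u → 6 ≤ d u
  6≤d = forbidden⇒minDegree 5 forbidden-44 G girth (≤-reflexive (sym degreeSum≡290))

  d≤7 : ∀ u → d u ≤ 7
  -- Eight neighbours of degree at least 6 would give 48, while `Âd<n` allows only 44.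
  d≤7 u = ≤-pred (*-cancelˡ-< 6 (d u) 8 (begin-strict
    6 * d u                      ≡⟨ cong (6 *_) (d-sum u) ⟩
    6 * sum (α u)                ≡⟨ *-distribˡ-sum 6 (α u) ⟩
    ∑[ v < 45 ] (6 * α u v)      ≤⟨ sum-mono (λ v → ≤-trans (*-monoˡ-≤ (α u v) (6≤d v)) (≤-reflexive (*-comm (d v) (α u v)))) ⟩
    Â d u                        <⟨ ≤-reflexive (+-comm 1 (Â d u)) ⟩
    Â d u + 1                    ≤⟨ Âd<n girth u ⟩
    45                           <⟨ from-yes (45 <? 48) ⟩
    48                           ∎))
    where open ≤-Reasoning

  d≡6+heavy : ∀ u → d u ≡ 6 + H u
  d≡6+heavy u = from-yes (allUpTo? (λ d → (6 ≤? d) →-dec (d ≟ 6 + heavy d)) 8) (s≤s (d≤7 u)) (6≤d u)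

  h≡20 : h ≡ 20
  -- 270 = 6 * 45, and each heavy vertex exceeds degree 6 by one.
  h≡20 = +-cancelˡ-≡ 270 h 20 (begin
    270 + h                      ≡⟨⟩
    ∑[ u < 45 ] 6 + sum H        ≡⟨ ∑-distrib-+ {45} (const 6) H ⟨
    ∑[ u < 45 ] (6 + H u)        ≡⟨ sum-cong-≗ d≡6+heavy ⟨
    degreeSum                    ≡⟨ degreeSum≡290 ⟩
    290                          ∎)
    where open ≡-Reasoning

  -- At h = 20 the terms of `balance` outside the sums cancel, so total supply is at most total
  -- demand. Since demand is at most supply at each vertex, the two agree everywhere.
  c+2heavy≡4 : ∀ u → c u + 2 * H u ≡ 4
  c+2heavy≡4 u = extremal-tight (s≤s (d≤7 u)) (s≤s (c≤d u)) (6≤d u)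
    (sum-tight (λ v → extremal-valid (s≤s (d≤7 v)) (s≤s (c≤d v)) (6≤d v))
               -- 191 * 20 = 20 * 20 + 3 * (45 * 20) + 720 = 3820
               (+-cancelʳ-≤ 3820 _ _ (subst
                 (λ x → ∑[ v < 45 ] supply (d v) (c v) + 191 * x ≤
                        ∑[ v < 45 ] demand (d v) (c v) + (x * x + 3 * (45 * x) + 720))
                 h≡20 (balance G girth extremal))) u)
    where open Multipliers extremal

  -- If degree `k` did not occur, `H` would be constantly `b` and h = 20 would equal 45b.
  degree-attained : ∀ k b → (∀ u → d u ≢ k → H u ≡ b) → b * 45 ≢ 20 → ∃ λ u → d u ≡ k
  degree-attained k b otherwise b*45≢20 with Fin.any? (λ u → d u ≟ k)
  ... | yes attained = attained
  ... | no  ¬attained = contradiction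
        (trans (sym (trans (sum-cong-≗ λ u → otherwise u λ e → ¬attained (u , e)) (sum-const 45 b))) h≡20)
        b*45≢20

  -- All degrees are 6 or 7, so equal degree means equally heavy, and x, y in {0, 1} satisfy [x = y]
  -- + x + y = 1 + 2xy. This identity is summed over the neighbours of `v`.
  sameDegree-count : ∀ v → length (sameDegreeNeighbours G v) + c v + H v * d v ≡ d v + 2 * (H v * c v)
  sameDegree-count v = begin
    length (sameDegreeNeighbours G v) + c v + H v * d v
      ≡⟨ cong₂ (λ x y → x + c v + y)
           (length-filter-filter-tabulate (λ w → d w ≟ d v) (adj? v) id)
           (trans (cong (H v *_) (d-sum v)) (*-distribˡ-sum (H v) (α v))) ⟩
    ∑[ w < 45 ] (α v w * same w) + c v + ∑[ w < 45 ] (H v * α v w)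
      ≡⟨ cong (_+ ∑[ w < 45 ] (H v * α v w)) (∑-distrib-+ (λ w → α v w * same w) (λ w → α v w * H w)) ⟨
    ∑[ w < 45 ] (α v w * same w + α v w * H w) + ∑[ w < 45 ] (H v * α v w)
      ≡⟨ ∑-distrib-+ (λ w → α v w * same w + α v w * H w) (λ w → H v * α v w) ⟨
    ∑[ w < 45 ] (α v w * same w + α v w * H w + H v * α v w)
      ≡⟨ sum-cong-≗ (λ w → trans (factor (α v w) (same w) (H w) (H v))
           (trans (cong (α v w *_) (same+heavy w)) (expand (α v w) (H w) (H v)))) ⟩
    ∑[ w < 45 ] (α v w + (2 * H v) * (α v w * H w))
      ≡⟨ ∑-distrib-+ (α v) (λ w → (2 * H v) * (α v w * H w)) ⟩
    sum (α v) + ∑[ w < 45 ] ((2 * H v) * (α v w * H w))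
      ≡⟨ cong₂ _+_ (sym (d-sum v)) (sym (*-distribˡ-sum (2 * H v) (λ w → α v w * H w))) ⟩
    d v + (2 * H v) * c v
      ≡⟨ cong (d v +_) (*-assoc 2 (H v) (c v)) ⟩
    d v + 2 * (H v * c v) ∎
    where
    open Graph G using (adj?)
    open ≡-Reasoning
    same : Fin 45 → ℕ
    same w = ⟦ d w ≟ d v ⟧
    same+heavy : ∀ w → same w + H w + H v ≡ 1 + 2 * (H v * H w)
    same+heavy w = from-yes (allUpTo? (λ x → allUpTo? (λ y → (6 ≤? x) →-dec ((6 ≤? y) →-dec
        (⟦ x ≟ y ⟧ + heavy x + heavy y ≟ 1 + 2 * (heavy y * heavy x)))) 8) 8)
      (s≤s (d≤7 w)) (s≤s (d≤7 v)) (6≤d w) (6≤d v)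
    factor : ∀ a s x y → a * s + a * x + y * a ≡ a * (s + x + y)
    factor = solve-∀
    expand : ∀ a x y → a * (1 + 2 * (y * x)) ≡ a + (2 * y) * (a * x)
    expand = solve-∀

  -- A vertex of degree 6 has 4 heavy neighbours, which leaves 2 of degree 6; a vertex of degree 7
  -- has exactly 2 heavy ones.
  two-sameDegreeNeighbours : ∀ v → length (sameDegreeNeighbours G v) ≡ 2
  two-sameDegreeNeighbours v =
    conclude (7 ≤? d v) (sameDegree-count v) (d≡6+heavy v) (c+2heavy≡4 v)
    where
    -- The decision behind `H v` is generalised so that one match evaluates it in all three
    -- hypotheses.
    conclude : ∀ {A : Set} (a? : Dec A) {N c d} → N + c + ⟦ a? ⟧ * d ≡ d + 2 * (⟦ a? ⟧ * c) →
               d ≡ 6 + ⟦ a? ⟧ → c + 2 * ⟦ a? ⟧ ≡ 4 → N ≡ 2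
    conclude (no _)  {N} {c} N-count refl c+0≡4 with refl ← trans (sym (+-identityʳ c)) c+0≡4 =
      +-cancelʳ-≡ 4 N 2 (trans (sym (+-identityʳ (N + 4))) N-count)
    conclude (yes _) {N} {c} N-count refl c+2≡4 with refl ← +-cancelʳ-≡ 2 c 2 c+2≡4 =
      +-cancelʳ-≡ 9 N 2 (trans (sym (+-assoc N 2 7)) N-count)

lemma1p1 : (G : Graph 45) → Girth≥5 G → edgeCount G ≡ 145 →
    IsMinDegree G 6 × IsMaxDegree G 7 ×
    ((v : Fin 45) → length (sameDegreeNeighbours G v) ≡ 2)
lemma1p1 G girth e =
  (degree-attained G girth e 6 1 heavy-otherwise (λ ()) , 6≤d G girth e) ,
  (degree-attained G girth e 7 0 light-otherwise (λ ()) , d≤7 G girth e) ,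
  two-sameDegreeNeighbours G girth e
  where
  heavy-otherwise : ∀ u → degree G u ≢ 6 → heavy (degree G u) ≡ 1
  heavy-otherwise u d≢6 = ⟦⟧-yes (7 ≤? degree G u) (≤∧≢⇒< (6≤d G girth e u) (d≢6 ∘ sym))
  light-otherwise : ∀ u → degree G u ≢ 7 → heavy (degree G u) ≡ 0
  light-otherwise u d≢7 = ⟦⟧-no (7 ≤? degree G u) (λ 7≤d → d≢7 (≤-antisym (d≤7 G girth e u) 7≤d))
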